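{- Let $k\ge2$ be an integer and $q=p^r$ with $p$ prime and $r\ge1$. For $n\ge k$ let $$R_{2,3,\dots,k}(n)=\sum_{i=1}^{n}X_iX_{i+1}\cdots X_{i+k-1}\in\mathbb{F}_q[X_1,\dots,X_n],$$ with indices taken modulo $n$ in the residue system $\{1,\dots,n\}$. Then the sequence $\{S_{\mathbb{F}_q}(R_{2,3,\dots,k}(n))\}_{n\ge k}$ satisfies a homogeneous linear recurrence with integer coefficients.
   Context: For $F\in\mathbb{F}_q[X_1,\dots,X_n]$, $S_{\mathbb{F}_q}(F)=\sum_{\mathbf{x}\in\mathbb{F}_q^n}e^{\frac{2\pi i}{p}\mathrm{Tr}_{\mathbb{F}_q/\mathbb{F}_p}(F(\mathbf{x}))}$, with $\mathrm{Tr}_{\mathbb{F}_q/\mathbb{F}_p}$ the field trace. -}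

module Defs where

open import Level using (0ℓ)
open import Algebra.Bundles using (CommutativeRing)
open import Data.Nat as ℕ using (ℕ; zero; suc; NonZero)
open import Data.Nat.DivMod using (_mod_)
open import Data.Fin as Fin using (Fin; toℕ)
open import Data.List as List using (List; []; _∷_; length; allFin)
open import Data.List.Relation.Unary.Any using (Any)
open import Data.List.Relation.Unary.AllPairs using (AllPairs)
open import Data.Vec as Vec using (Vec; lookup)
open import Data.Integer as ℤ using (ℤ)
open import Data.Product using (Σ; ∃; _×_)
open import Relation.Nullary using (¬_)
open import Relation.Binary.Definitions using (Decidable)
open import Relation.Binary.PropositionalEquality using (_≡_)

record FiniteField : Set₁ where
  field
    commRing : CommutativeRing 0ℓ 0ℓ
  open CommutativeRing commRing public
  field
    _≟_        : Decidable _≈_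
    nontrivial : ¬ (1# ≈ 0#)
    inverse    : ∀ x → ¬ (x ≈ 0#) → ∃ λ y → (x * y) ≈ 1#
    elements   : List Carrier
    complete   : ∀ x → Any (x ≈_) elements
    distinct   : AllPairs (λ a b → ¬ (a ≈ b)) elements

  cardinality : ℕ
  cardinality = length elements

-- Elements of ℤ[ζ_p] (ζ_p = e^{2πi/p}) represented by integer
-- coefficient vectors c : Fin p → ℤ, meaning Σ_j c_j ζ_p^j.
-- Since 1 + ζ + … + ζ^{p-1} = 0 is the only relation (Φ_p is the
-- minimal polynomial of ζ_p), two vectors denote the same complex
-- number iff their difference is a constant vector.

Cyc : ℕ → Set
Cyc p = Fin p → ℤ

_≈ᶜ_ : ∀ {p} → Cyc p → Cyc p → Set
_≈ᶜ_ u v = ∃ λ (c : ℤ) → ∀ j → u j ℤ.- v j ≡ c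

_+ᶜ_ : ∀ {p} → Cyc p → Cyc p → Cyc p
(u +ᶜ v) j = u j ℤ.+ v j

_·ᶜ_ : ∀ {p} → ℤ → Cyc p → Cyc p
(a ·ᶜ u) j = a ℤ.* u j

0ᶜ : ∀ {p} → Cyc p
0ᶜ j = ℤ.0ℤ

sumᶜ : ∀ {p} d → (Fin d → Cyc p) → Cyc p
sumᶜ zero    f = 0ᶜ
sumᶜ (suc d) f = f Fin.zero +ᶜ sumᶜ d (λ i → f (Fin.suc i))

module _ (F : FiniteField) where
  open FiniteField F

  pow : Carrier → ℕ → Carrier
  pow x zero    = 1#
  pow x (suc m) = x * pow x m

  natElem : ℕ → Carrier
  natElem zero    = 0#
  natElem (suc m) = 1# + natElem m

  sumF : List Carrier → Carrier
  sumF = List.foldr _+_ 0#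

  prodF : List Carrier → Carrier
  prodF = List.foldr _*_ 1#

  trace : (p r : ℕ) → Carrier → Carrier
  trace p r x = sumF (List.map (λ i → pow x (p ℕ.^ toℕ i)) (allFin r))

  points : (n : ℕ) → List (Vec Carrier n)
  points zero    = Vec.[] ∷ []
  points (suc n) =
    List.concatMap (λ a → List.map (a Vec.∷_) (points n)) elements

  -- R_{2,3,…,k}(n)(x) = Σ_{i=1}^n x_i x_{i+1} ⋯ x_{i+k-1}, indices mod n
  -- (0-based here: Σ_{i<n} Π_{j<k} x_{(i+j) mod n}).
  R : (k : ℕ) → {n : ℕ} → Vec Carrier n → Carrier
  R k {zero}    x = 0#
  R k {suc m}   x =
    sumF (List.map
      (λ i → prodF (List.map
        (λ j → lookup x ((toℕ i ℕ.+ toℕ j) mod (suc m)))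
        (allFin k)))
      (allFin (suc m)))

  count : (p r n : ℕ) → (Vec Carrier n → Carrier) → Fin p → ℕ
  count p r n P j =
    length (List.filter (λ x → trace p r (P x) ≟ natElem (toℕ j)) (points n))

  -- S_{F_q}(P) = Σ_{x ∈ F_q^n} ζ_p^{Tr(P(x))} = Σ_j count_j ζ_p^j ∈ ℤ[ζ_p]
  expSum : (p r n : ℕ) → (Vec Carrier n → Carrier) → Cyc p
  expSum p r n P j = ℤ.+ (count p r n P j)

  S-R : (p r k n : ℕ) → Cyc p
  S-R p r k n = expSum p r n (R k)

{-# OPTIONS --safe #-}
module Submission where

-- Transfer matrix: cutting a cyclic word after its first k − 1 letters s and
-- reading the remaining letters one by one through a sliding window expresses
-- S(R(n)) by finitely many sequences that form a first-order linear system with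
-- integer coefficients. Such a system is solved over ℤ by elimination: with E
-- the shift, if Eᵈw and Eᵈu are combinations of the unknowns with coefficients
-- in ℤ[E] of degree < d, then applying Eᵈ − C to the equation of u, where C is
-- the coefficient of w in the equation of w, removes w and yields an equation of
-- the same shape for E²ᵈu. What is left at the end is a monic recurrence, so no
-- determinants are needed.

open import Defs
open import Level using (0ℓ)
open import Data.Nat using (ℕ; zero; suc; _≤_; _<_; s≤s; _+_; _∸_; _^_)
open import Data.Nat.DivMod using (_mod_; _%_; [m+n]%n≡m%n; m<n⇒m%n≡m; m%n<n)
import Data.Nat.Properties as ℕₚ
open import Data.Nat.Primality using (Prime)
open import Data.Fin using (Fin; toℕ)
import Data.Fin as Fin
import Data.Fin.Properties as Finₚ
open import Data.Integer using (ℤ; 0ℤ; 1ℤ; -1ℤ)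
import Data.Integer as ℤ
import Data.Integer.Properties as ℤₚ
open import Data.Integer.Tactic.RingSolver using (solve-∀)
open import Data.Bool using (true; false; if_then_else_)
open import Data.List as List using
  (List; []; _∷_; _++_; length; map; concatMap; filter; allFin; cartesianProduct)
import Data.List.Properties as Listₚ
open import Data.List.Membership.Propositional using (_∈_; find; lose)
open import Data.List.Membership.Propositional.Properties
  using (∈-concatMap⁺; ∈-concatMap⁻; ∈-map⁺; ∈-map⁻; ∈-cartesianProduct⁺; ∈-cartesianProduct⁻)
import Data.List.Relation.Unary.All.Properties as Allₚ
import Data.List.Relation.Unary.Any.Properties as Anyₚ
open import Data.List.Relation.Unary.All as All using (All; []; _∷_)
open import Data.List.Relation.Unary.Any using (Any; here; there)
open import Data.Vec as Vec using (Vec; []; _∷_)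
import Data.Vec.Properties as Vecₚ
open import Data.Product using (∃; ∃-syntax; _×_; _,_; proj₂)
open import Function using (_∘_; id; mk⇔)
open import Relation.Nullary using (does; yes; no)
open import Relation.Nullary.Decidable using (does-⇔)
open import Relation.Unary using (Pred; Decidable)
open import Relation.Binary.PropositionalEquality

-- Integer sums over lists

∑ : {A : Set} → List A → (A → ℤ) → ℤ
∑ []       f = 0ℤ
∑ (x ∷ xs) f = f x ℤ.+ ∑ xs f

∑-cong : {A : Set} (xs : List A) {f g : A → ℤ} → (∀ x → f x ≡ g x) → ∑ xs f ≡ ∑ xs g
∑-cong []       e = refl
∑-cong (x ∷ xs) e = cong₂ ℤ._+_ (e x) (∑-cong xs e)

∑-++ : {A : Set} (xs ys : List A) (f : A → ℤ) → ∑ (xs ++ ys) f ≡ ∑ xs f ℤ.+ ∑ ys f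
∑-++ []       ys f = sym (ℤₚ.+-identityˡ _)
∑-++ (x ∷ xs) ys f = trans (cong (ℤ._+_ (f x)) (∑-++ xs ys f)) (sym (ℤₚ.+-assoc (f x) _ _))

∑-map : {A B : Set} (g : A → B) (xs : List A) (f : B → ℤ) → ∑ (map g xs) f ≡ ∑ xs (f ∘ g)
∑-map g []       f = refl
∑-map g (x ∷ xs) f = cong (ℤ._+_ (f (g x))) (∑-map g xs f)

∑-concatMap : {A B : Set} (g : A → List B) (xs : List A) (f : B → ℤ) →
  ∑ (concatMap g xs) f ≡ ∑ xs (λ x → ∑ (g x) f)
∑-concatMap g []       f = refl
∑-concatMap g (x ∷ xs) f =
  trans (∑-++ (g x) _ f) (cong (ℤ._+_ (∑ (g x) f)) (∑-concatMap g xs f))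

map-tabulate-suc : ∀ {A : Set} {n} (f : Fin (suc n) → A) →
  map f (List.tabulate Fin.suc) ≡ map (f ∘ Fin.suc) (allFin n)
map-tabulate-suc f =
  trans (Listₚ.map-tabulate Fin.suc f) (sym (Listₚ.map-tabulate id (f ∘ Fin.suc)))

length-filter-∑ : {A : Set} {P : Pred A 0ℓ} (P? : Decidable P) (xs : List A) →
  ℤ.+ length (filter P? xs) ≡ ∑ xs (λ x → if does (P? x) then 1ℤ else 0ℤ)
length-filter-∑ P? []       = refl
length-filter-∑ P? (x ∷ xs) with does (P? x)
... | true  = cong (ℤ._+_ 1ℤ) (length-filter-∑ P? xs)
... | false = trans (length-filter-∑ P? xs) (sym (ℤₚ.+-identityˡ _))

-- Sequences as a module over polynomials in the shift operator

module Recurrence {p : ℕ} where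

  Seq : Set
  Seq = ℕ → Cyc p

  infix 4 _≈ₛ_
  -- Finer than `_≈ᶜ_`: the recurrence is proved for the coefficient vectors themselves, before the
  -- relation among the powers of ζ is imposed.
  _≈ₛ_ : Seq → Seq → Set
  u ≈ₛ v = ∀ n x → u n x ≡ v n x

  shift : ℕ → Seq → Seq
  shift d u n = u (d + n)

  -- One operation covers both addition (`a = 1`) and subtraction (`a = −1`), so linearity is proved
  -- once for each construction.
  lin : ℤ → Seq → Seq → Seq
  lin a u v n x = a ℤ.* u n x ℤ.+ v n x

  -- The action of a polynomial in the shift operator, given by its
  -- coefficients from the constant term upwards; Vec ℤ d is degree < d.
  eval : ∀ {d} → Vec ℤ d → Seq → Seq
  eval []      u n x = 0ℤ
  eval (a ∷ A) u n x = a ℤ.* u n x ℤ.+ eval A u (suc n) x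

  eval-cong : ∀ {d} (A : Vec ℤ d) {u v} → u ≈ₛ v → eval A u ≈ₛ eval A v
  eval-cong []      e n x = refl
  eval-cong (a ∷ A) e n x =
    cong₂ (λ s t → a ℤ.* s ℤ.+ t) (e n x) (eval-cong A e (suc n) x)

  eval-shift : ∀ {d} (A : Vec ℤ d) k u → eval A (shift k u) ≈ₛ shift k (eval A u)
  eval-shift []      k u n x = refl
  eval-shift (a ∷ A) k u n x = cong (ℤ._+_ (a ℤ.* u (k + n) x))
    (trans (eval-shift A k u (suc n) x)
           (cong (λ i → eval A u i x) (ℕₚ.+-suc k n)))

  eval-lin : ∀ {d} (A : Vec ℤ d) a u v →
    eval A (lin a u v) ≈ₛ lin a (eval A u) (eval A v)
  eval-lin []      a u v n x = sym (trans (ℤₚ.+-identityʳ _) (ℤₚ.*-zeroʳ a))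
  eval-lin (b ∷ A) a u v n x =
    trans (cong (ℤ._+_ (b ℤ.* (a ℤ.* u n x ℤ.+ v n x))) (eval-lin A a u v (suc n) x))
          (rearrange a b (u n x) (v n x) (eval A u (suc n) x) (eval A v (suc n) x))
    where
    rearrange : ∀ a b s t s′ t′ →
      b ℤ.* (a ℤ.* s ℤ.+ t) ℤ.+ (a ℤ.* s′ ℤ.+ t′) ≡
      a ℤ.* (b ℤ.* s ℤ.+ s′) ℤ.+ (b ℤ.* t ℤ.+ t′)
    rearrange = solve-∀

  eval-0 : ∀ {d} (A : Vec ℤ d) {u} → (∀ n x → u n x ≡ 0ℤ) → ∀ n x → eval A u n x ≡ 0ℤ
  eval-0 []      z n x = refl
  eval-0 (a ∷ A) z n x =
    cong₂ ℤ._+_ (trans (cong (a ℤ.*_) (z n x)) (ℤₚ.*-zeroʳ a)) (eval-0 A z (suc n) x)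

  -- `eval A` is built from `lin` and the single shift, and `eval B` commutes with both.
  eval-comm : ∀ {d e} (A : Vec ℤ d) (B : Vec ℤ e) u →
    eval A (eval B u) ≈ₛ eval B (eval A u)
  eval-comm []      B u n x = sym (eval-0 B (λ _ _ → refl) n x)
  eval-comm (a ∷ A) B u n x = sym (trans
    (eval-lin B a u (shift 1 (eval A u)) n x)
    (cong (ℤ._+_ (a ℤ.* eval B u n x))
      (trans (eval-shift B 1 (eval A u) n x) (sym (eval-comm A B u (suc n) x)))))

  -- Arithmetic of polynomials with degree bounds

  zeros : ∀ d → Vec ℤ d
  zeros d = Vec.replicate d 0ℤ

  eval-zeros : ∀ d u n x → eval (zeros d) u n x ≡ 0ℤ
  eval-zeros zero    u n x = refl
  eval-zeros (suc d) u n x = trans (ℤₚ.+-identityˡ _) (eval-zeros d u (suc n) x)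

  linᵖ : ∀ {d} → ℤ → Vec ℤ d → Vec ℤ d → Vec ℤ d
  linᵖ a = Vec.zipWith (λ s t → a ℤ.* s ℤ.+ t)

  eval-linᵖ : ∀ {d} a (A B : Vec ℤ d) u →
    eval (linᵖ a A B) u ≈ₛ lin a (eval A u) (eval B u)
  eval-linᵖ a []      []      u n x = sym (trans (ℤₚ.+-identityʳ _) (ℤₚ.*-zeroʳ a))
  eval-linᵖ a (b ∷ A) (c ∷ B) u n x =
    trans (cong (ℤ._+_ ((a ℤ.* b ℤ.+ c) ℤ.* u n x)) (eval-linᵖ a A B u (suc n) x))
          (rearrange a b c (u n x) (eval A u (suc n) x) (eval B u (suc n) x))
    where
    rearrange : ∀ a b c t s′ t′ →
      (a ℤ.* b ℤ.+ c) ℤ.* t ℤ.+ (a ℤ.* s′ ℤ.+ t′) ≡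
      a ℤ.* (b ℤ.* t ℤ.+ s′) ℤ.+ (c ℤ.* t ℤ.+ t′)
    rearrange = solve-∀

  eval-∷ʳ0 : ∀ {d} (A : Vec ℤ d) u → eval (A Vec.∷ʳ 0ℤ) u ≈ₛ eval A u
  eval-∷ʳ0 []      u n x = refl
  eval-∷ʳ0 (a ∷ A) u n x = cong (ℤ._+_ (a ℤ.* u n x)) (eval-∷ʳ0 A u (suc n) x)

  -- The zeros go to the high-degree end, so only the degree bound changes; zeros in front, as in
  -- `shiftᵖ`, multiply by a power of E.
  pad : ∀ d {e} → Vec ℤ e → Vec ℤ (d + e)
  pad zero    A = A
  pad (suc d) A = pad d A Vec.∷ʳ 0ℤ

  eval-pad : ∀ d {e} (A : Vec ℤ e) u → eval (pad d A) u ≈ₛ eval A u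
  eval-pad zero    A u n x = refl
  eval-pad (suc d) A u n x = trans (eval-∷ʳ0 (pad d A) u n x) (eval-pad d A u n x)

  -- Horner's scheme: `(a + E A) B = a B + E (A B)`. The bound `d + e` is not sharp, but agrees with
  -- that of `shiftᵖ`, so products and shifts can be added.
  mul : ∀ {d e} → Vec ℤ d → Vec ℤ e → Vec ℤ (d + e)
  mul {e = e} []      B = zeros e
  mul {suc d} (a ∷ A) B = linᵖ a (pad (suc d) B) (0ℤ ∷ mul A B)

  eval-mul : ∀ {d e} (A : Vec ℤ d) (B : Vec ℤ e) u →
    eval (mul A B) u ≈ₛ eval A (eval B u)
  eval-mul {e = e} []      B u n x = eval-zeros e u n x
  eval-mul {suc d} (a ∷ A) B u n x = trans
    (eval-linᵖ a (pad (suc d) B) (0ℤ ∷ mul A B) u n x)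
    (cong₂ (λ s t → a ℤ.* s ℤ.+ t)
      (eval-pad (suc d) B u n x)
      (trans (ℤₚ.+-identityˡ _) (eval-mul A B u (suc n) x)))

  shiftᵖ : ∀ d {e} → Vec ℤ e → Vec ℤ (d + e)
  shiftᵖ d A = zeros d Vec.++ A

  eval-shiftᵖ : ∀ d {e} (A : Vec ℤ e) u → eval (shiftᵖ d A) u ≈ₛ shift d (eval A u)
  eval-shiftᵖ zero    A u n x = refl
  eval-shiftᵖ (suc d) A u n x = trans (ℤₚ.+-identityˡ _)
    (trans (eval-shiftᵖ d A u (suc n) x) (cong (λ i → eval A u i x) (ℕₚ.+-suc d n)))

  -- Combinations with polynomial coefficients

  -- One coefficient per list entry, in list order, so that isolating the coefficient of the head
  -- unknown is pattern matching. Equations are pointwise, which avoids function extensionality.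
  data Span (d : ℕ) : List Seq → Seq → Set where
    []  : ∀ {u} → (∀ n x → u n x ≡ 0ℤ) → Span d [] u
    add : ∀ {w ws u v} (A : Vec ℤ d) → Span d ws v →
          (∀ n x → u n x ≡ eval A w n x ℤ.+ v n x) → Span d (w ∷ ws) u

  Span-resp : ∀ {d ws u v} → u ≈ₛ v → Span d ws u → Span d ws v
  Span-resp e ([] z)      = [] λ n x → trans (sym (e n x)) (z n x)
  Span-resp e (add A s q) = add A s λ n x → trans (sym (e n x)) (q n x)

  Span-0 : ∀ {d} ws → Span d ws (λ _ _ → 0ℤ)
  Span-0 []       = [] λ _ _ → refl
  Span-0 {d} (w ∷ ws) = add (zeros d) (Span-0 ws)
    λ n x → sym (trans (ℤₚ.+-identityʳ _) (eval-zeros d w n x))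

  Span-weaken : ∀ {d ws u} w → Span d ws u → Span d (w ∷ ws) u
  Span-weaken {d} {u = u} w s = add (zeros d) s
    λ n x → sym (trans (cong (ℤ._+ u n x) (eval-zeros d w n x)) (ℤₚ.+-identityˡ _))

  Span-lin : ∀ {d ws u v} a → Span d ws u → Span d ws v → Span d ws (lin a u v)
  Span-lin a ([] y) ([] z) = [] λ n x →
    trans (cong₂ (λ s t → a ℤ.* s ℤ.+ t) (y n x) (z n x))
          (trans (ℤₚ.+-identityʳ _) (ℤₚ.*-zeroʳ a))
  Span-lin {ws = w ∷ _} a (add {v = v} A s p) (add {v = v′} B t q) =
    add (linᵖ a A B) (Span-lin a s t) λ n x →
      trans (cong₂ (λ s t → a ℤ.* s ℤ.+ t) (p n x) (q n x))
      (trans (rearrange a (eval A w n x) (v n x) (eval B w n x) (v′ n x))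
      (cong (ℤ._+ lin a v v′ n x) (sym (eval-linᵖ a A B w n x))))
    where
    rearrange : ∀ a s s′ t t′ →
      a ℤ.* (s ℤ.+ s′) ℤ.+ (t ℤ.+ t′) ≡ (a ℤ.* s ℤ.+ t) ℤ.+ (a ℤ.* s′ ℤ.+ t′)
    rearrange = solve-∀

  Span-+ : ∀ {d ws u v} → Span d ws u → Span d ws v →
    Span d ws (λ n x → u n x ℤ.+ v n x)
  Span-+ {u = u} {v} s t =
    Span-resp (λ n x → cong (ℤ._+ v n x) (ℤₚ.*-identityˡ (u n x))) (Span-lin 1ℤ s t)

  eval-+ : ∀ {d} (A : Vec ℤ d) u v n x →
    eval A (λ n x → u n x ℤ.+ v n x) n x ≡ eval A u n x ℤ.+ eval A v n x
  eval-+ A u v n x = trans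
    (eval-cong A (λ n x → cong (ℤ._+ v n x) (sym (ℤₚ.*-identityˡ (u n x)))) n x)
    (trans (eval-lin A 1ℤ u v n x) (cong (ℤ._+ eval A v n x) (ℤₚ.*-identityˡ (eval A u n x))))

  Span-eval : ∀ {d e ws u} (A : Vec ℤ d) → Span e ws u → Span (d + e) ws (eval A u)
  Span-eval A ([] z) = [] (eval-0 A z)
  Span-eval {ws = w ∷ _} A (add {v = v} B s q) =
    add (mul A B) (Span-eval A s) λ n x →
      trans (eval-cong A q n x)
      (trans (eval-+ A (eval B w) v n x)
             (cong (ℤ._+ eval A v n x) (sym (eval-mul A B w n x))))

  Span-∑ : ∀ {A : Set} {d ws} (xs : List A) (f : A → Seq) →
    (∀ {a} → a ∈ xs → Span d ws (f a)) → Span d ws (λ n x → ∑ xs (λ a → f a n x))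
  Span-∑ {ws = ws} []       f h = Span-0 ws
  Span-∑           (a ∷ xs) f h = Span-+ (h (here refl)) (Span-∑ xs f (h ∘ there))

  Span-shift : ∀ d {e ws u} → Span e ws u → Span (d + e) ws (shift d u)
  Span-shift d ([] z) = [] λ n → z (d + n)
  Span-shift d {ws = w ∷ _} (add {v = v} B s q) =
    add (shiftᵖ d B) (Span-shift d s) λ n x →
      trans (q (d + n) x) (cong (ℤ._+ v (d + n) x) (sym (eval-shiftᵖ d B w n x)))

  -- Bound 1 means constant integer coefficients. Membership is up to `_≈ₛ_` because the field comes
  -- with its own equality.
  Span-member : ∀ {ws u} → Any (u ≈ₛ_) ws → Span 1 ws u
  Span-member {w ∷ ws} (here e) = add (1ℤ ∷ []) (Span-0 ws) λ n x →
    trans (e n x) (rearrange (w n x))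
    where
    rearrange : ∀ t → t ≡ 1ℤ ℤ.* t ℤ.+ 0ℤ ℤ.+ 0ℤ
    rearrange = solve-∀
  Span-member {w ∷ ws} (there p) = Span-weaken w (Span-member p)

  -- In the equation of `w` within the system, `w` occurs twice: as its own unknown and as an entry
  -- of the list. Collecting both terms gives the coefficient C used in the elimination.
  Span-merge : ∀ {d w ws u} → Span d (w ∷ w ∷ ws) u → Span d (w ∷ ws) u
  Span-merge {w = w} (add A (add {v = v} B s q) p) = add (linᵖ 1ℤ A B) s λ n x →
    trans (p n x) (trans (cong (ℤ._+_ (eval A w n x)) (q n x))
    (trans (rearrange (eval A w n x) (eval B w n x) (v n x))
           (cong (ℤ._+ v n x) (sym (eval-linᵖ 1ℤ A B w n x)))))
    where
    rearrange : ∀ a b c → a ℤ.+ (b ℤ.+ c) ≡ (1ℤ ℤ.* a ℤ.+ b) ℤ.+ c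
    rearrange = solve-∀

  -- Elimination of unknowns

  -- The coefficient P of `u` on the right has degree < d, so Eᵈ - P is monic; with `ws` empty this
  -- is a monic recurrence for `u` alone.
  Monic : ℕ → List Seq → Seq → Set
  Monic d ws u = Span d (u ∷ ws) (shift d u)

  -- If Eᵈw = C w + c and Eᵈu = P u + A w + b, apply Eᵈ − C to the second
  -- equation and replace (Eᵈ − C) w by c.
  eliminate : ∀ {d w ws u} → Monic d (w ∷ ws) w → Monic d (w ∷ ws) u →
    Monic (d + d) ws u
  eliminate {d} {w} {ws} {u} mw (add P (add {v = b} A sb q) p) with Span-merge mw
  ... | add {v = c} C sc r =
    -- Expanding `(Eᵈ − C)(Eᵈ − P) u = (Eᵈ − C) b + A c`: the coefficient of `u` becomes
    -- `Eᵈ P + Eᵈ C − C P`, and the other unknowns contribute `Eᵈ b + A c − C b`.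
    add (linᵖ -1ℤ (mul C P) (linᵖ 1ℤ (shiftᵖ d P) (shiftᵖ d C)))
      (Span-lin -1ℤ (Span-eval C sb) (Span-+ (Span-shift d sb) (Span-eval A sc)))
      λ n x → begin
        u (d + d + n) x
          ≡⟨ cong (λ i → u i x) (ℕₚ.+-assoc d d n) ⟩
        u (d + (d + n)) x
          ≡⟨ trans (p (d + n) x) (cong (ℤ._+_ (eval P u (d + n) x)) (q (d + n) x)) ⟩
        eval P u (d + n) x ℤ.+ (eval A w (d + n) x ℤ.+ b (d + n) x)
          ≡⟨ cong (λ t → eval P u (d + n) x ℤ.+ (t ℤ.+ b (d + n) x)) (Aw n x) ⟩
        eval P u (d + n) x ℤ.+ (eval C (eval A w) n x ℤ.+ eval A c n x ℤ.+ b (d + n) x)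
          -- Adding and subtracting `C P u` and `C b` completes `C A w` to `C Eᵈ u`, which removes
          -- `w`.
          ≡⟨ rearrange (eval P u (d + n) x) (eval C (eval A w) n x) (eval A c n x)
               (b (d + n) x) (eval C (eval P u) n x) (eval C b n x) ⟩
        (-1ℤ ℤ.* eval C (eval P u) n x ℤ.+ (1ℤ ℤ.* eval P u (d + n) x ℤ.+
          (eval C (eval P u) n x ℤ.+ (eval C (eval A w) n x ℤ.+ eval C b n x))))
          ℤ.+ rest n x
          ≡⟨ cong (λ t → (-1ℤ ℤ.* eval C (eval P u) n x ℤ.+
                 (1ℤ ℤ.* eval P u (d + n) x ℤ.+ t)) ℤ.+ rest n x) (sym (Cu n x)) ⟩
        (-1ℤ ℤ.* eval C (eval P u) n x ℤ.+ (1ℤ ℤ.* eval P u (d + n) x ℤ.+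
          eval C u (d + n) x)) ℤ.+ rest n x
          ≡⟨ cong (ℤ._+ rest n x) (sym (coeff n x)) ⟩
        eval (linᵖ -1ℤ (mul C P) (linᵖ 1ℤ (shiftᵖ d P) (shiftᵖ d C))) u n x
          ℤ.+ rest n x ∎
    where
    open ≡-Reasoning
    rest : Seq
    rest = lin -1ℤ (eval C b) (λ n x → b (d + n) x ℤ.+ eval A c n x)
    Aw : ∀ n x → eval A w (d + n) x ≡ eval C (eval A w) n x ℤ.+ eval A c n x
    Aw n x = trans (sym (eval-shift A d w n x)) (trans (eval-cong A r n x)
      (trans (eval-+ A (eval C w) c n x)
             (cong (ℤ._+ eval A c n x) (eval-comm A C w n x))))
    Cu : ∀ n x → eval C u (d + n) x ≡
      eval C (eval P u) n x ℤ.+ (eval C (eval A w) n x ℤ.+ eval C b n x)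
    Cu n x = trans (sym (eval-shift C d u n x)) (trans (eval-cong C p n x)
      (trans (eval-+ C (eval P u) _ n x) (cong (ℤ._+_ (eval C (eval P u) n x))
        (trans (eval-cong C q n x) (eval-+ C (eval A w) b n x)))))
    coeff : eval (linᵖ -1ℤ (mul C P) (linᵖ 1ℤ (shiftᵖ d P) (shiftᵖ d C))) u ≈ₛ
      lin -1ℤ (eval C (eval P u)) (lin 1ℤ (shift d (eval P u)) (shift d (eval C u)))
    coeff n x = trans (eval-linᵖ -1ℤ (mul C P) _ u n x)
      (cong₂ (λ s t → -1ℤ ℤ.* s ℤ.+ t) (eval-mul C P u n x)
        (trans (eval-linᵖ 1ℤ (shiftᵖ d P) (shiftᵖ d C) u n x)
          (cong₂ (λ s t → 1ℤ ℤ.* s ℤ.+ t)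
            (eval-shiftᵖ d P u n x) (eval-shiftᵖ d C u n x))))
    rearrange : ∀ Pu CAw Ac b CPu Cb →
      Pu ℤ.+ (CAw ℤ.+ Ac ℤ.+ b) ≡
      (-1ℤ ℤ.* CPu ℤ.+ (1ℤ ℤ.* Pu ℤ.+ (CPu ℤ.+ (CAw ℤ.+ Cb)))) ℤ.+
      (-1ℤ ℤ.* Cb ℤ.+ (b ℤ.+ Ac))
    rearrange = solve-∀

  -- Each round removes the head unknown from all remaining equations and from that of `u`, and
  -- doubles the common degree bound.
  eliminateAll : ∀ {d} ws {u} → All (Monic d ws) ws → Monic d ws u →
    ∃ λ d′ → Monic d′ [] u
  eliminateAll {d} []       []         mu = d , mu
  eliminateAll (w ∷ ws) (mw ∷ mws) mu =
    eliminateAll ws (All.map (eliminate mw) mws) (eliminate mw mu)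

  -- From shift polynomials to explicit recurrences

  sumᶜ-cong : ∀ d {f g : Fin d → Cyc p} → (∀ i j → f i j ≡ g i j) →
    ∀ j → sumᶜ d f j ≡ sumᶜ d g j
  sumᶜ-cong zero    e j = refl
  sumᶜ-cong (suc d) e j =
    cong₂ ℤ._+_ (e Fin.zero j) (sumᶜ-cong d (λ i → e (Fin.suc i)) j)

  eval-sum : ∀ {d} (A : Vec ℤ d) u n j →
    eval A u n j ≡ sumᶜ d (λ i → Vec.lookup A i ·ᶜ u (n + toℕ i)) j
  eval-sum [] u n j = refl
  eval-sum {suc d} (a ∷ A) u n j = cong₂ ℤ._+_
    (cong (λ i → a ℤ.* u i j) (sym (ℕₚ.+-identityʳ n)))
    (trans (eval-sum A u (suc n) j)
      (sumᶜ-cong d (λ i j → cong (λ k → Vec.lookup A i ℤ.* u k j)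
        (sym (ℕₚ.+-suc n (toℕ i)))) j))

  linearRecurrence : ∀ ws {u} → All (λ w → Span 1 ws (shift 1 w)) ws →
    Span 1 ws (shift 1 u) →
    ∃[ d ] ∃ λ (a : Fin d → ℤ) →
      ∀ n j → u (n + d) j ≡ sumᶜ d (λ i → a i ·ᶜ u (n + toℕ i)) j
  linearRecurrence ws {u} hs h
    -- The start is `d = 1`; `Span-weaken` puts each sequence in front of the list with coefficient
    -- 0, as `Monic` demands.
    with eliminateAll ws (All.map (λ {w} → Span-weaken w) hs) (Span-weaken u h)
  ... | d , add A ([] z) e = d , Vec.lookup A , λ n j → begin
    u (n + d) j                ≡⟨ cong (λ i → u i j) (ℕₚ.+-comm n d) ⟩
    u (d + n) j                ≡⟨ e n j ⟩
    eval A u n j ℤ.+ _         ≡⟨ cong (ℤ._+_ (eval A u n j)) (z n j) ⟩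
    eval A u n j ℤ.+ 0ℤ        ≡⟨ ℤₚ.+-identityʳ _ ⟩
    eval A u n j               ≡⟨ eval-sum A u n j ⟩
    sumᶜ d (λ i → Vec.lookup A i ·ᶜ u (n + toℕ i)) j ∎
    where open ≡-Reasoning


-- The additive character

module Transfer (F : FiniteField) (p r : ℕ) where

  module 𝔽 = FiniteField F
  open 𝔽 using (Carrier; elements)
  open Recurrence {p}

  -- For a field of `p ^ r` elements with `p` prime, this is the coefficient vector of ζ to the
  -- power Tr(z).
  χ : Carrier → Cyc p
  χ z j = if does (trace F p r z 𝔽.≟ natElem F (toℕ j)) then 1ℤ else 0ℤ

  pow-cong : ∀ {x y} → x 𝔽.≈ y → ∀ n → pow F x n 𝔽.≈ pow F y n
  pow-cong e zero    = 𝔽.refl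
  pow-cong e (suc n) = 𝔽.*-cong e (pow-cong e n)

  sumF-cong : ∀ {A : Set} {f g : A → Carrier} → (∀ i → f i 𝔽.≈ g i) →
    ∀ xs → sumF F (map f xs) 𝔽.≈ sumF F (map g xs)
  sumF-cong e []       = 𝔽.refl
  sumF-cong e (x ∷ xs) = 𝔽.+-cong (e x) (sumF-cong e xs)

  trace-cong : ∀ {x y} → x 𝔽.≈ y → trace F p r x 𝔽.≈ trace F p r y
  trace-cong e = sumF-cong (λ i → pow-cong e (p ^ toℕ i)) (allFin r)

  χ-cong : ∀ {x y} → x 𝔽.≈ y → ∀ j → χ x j ≡ χ y j
  χ-cong {x} {y} e j = cong (λ b → if b then 1ℤ else 0ℤ)
    (does-⇔ (mk⇔ (𝔽.trans (𝔽.sym (trace-cong e))) (𝔽.trans (trace-cong e)))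
      (trace F p r x 𝔽.≟ natElem F (toℕ j)) (trace F p r y 𝔽.≟ natElem F (toℕ j)))

  -- Window sums along a word

  -- Total indexing with default `0#` spares index proofs; the windows summed in `walks` stay inside
  -- the word.
  nth : List Carrier → ℕ → Carrier
  nth []       i       = 𝔽.0#
  nth (x ∷ xs) zero    = x
  nth (x ∷ xs) (suc i) = nth xs i

  -- The analogue of `R` without wrap-around: `N` windows of length `k` along an unrolled word.
  windowSum : (k N : ℕ) → (ℕ → Carrier) → Carrier
  windowSum k N f = sumF F (map
    (λ (i : Fin N) → prodF F (map (λ (j : Fin k) → f (toℕ i + toℕ j)) (allFin k)))
    (allFin N))

  windowSum-suc : ∀ k N f → windowSum k (suc N) f ≡
    prodF F (map (λ (j : Fin k) → f (toℕ j)) (allFin k)) 𝔽.+ windowSum k N (f ∘ suc)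
  windowSum-suc k N f = cong
    (λ l → prodF F (map (λ (j : Fin k) → f (toℕ j)) (allFin k)) 𝔽.+ sumF F l)
    (map-tabulate-suc {n = N}
      (λ i → prodF F (map (λ (j : Fin k) → f (toℕ i + toℕ j)) (allFin k))))

  windowSum-cong : ∀ m N {f g} → (∀ i → i < N + m → f i ≡ g i) →
    windowSum (suc m) N f ≡ windowSum (suc m) N g
  windowSum-cong m N e = cong (sumF F) (Listₚ.map-cong
    (λ i → cong (prodF F) (Listₚ.map-cong
      (λ j → e _ (ℕₚ.+-mono-<-≤ (Finₚ.toℕ<n i) (Finₚ.toℕ≤pred[n] j)))
      (allFin (suc m))))
    (allFin N))

  nth-prefix : ∀ {k} (w : Vec Carrier k) l →
    map (λ (j : Fin k) → nth (Vec.toList w ++ l) (toℕ j)) (allFin k) ≡ Vec.toList w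
  nth-prefix []      l = refl
  nth-prefix {suc k} (x ∷ w) l = cong (x ∷_)
    (trans (map-tabulate-suc {n = k} (λ j → nth (x ∷ Vec.toList w ++ l) (toℕ j)))
           (nth-prefix w l))

  -- The first letter lies in the first window only, so it can be forgotten once that product is
  -- split off. This is one move of the sliding window.
  windowSum-prefix : ∀ {m} N (w : Vec Carrier (suc m)) l →
    windowSum (suc m) (suc N) (nth (Vec.toList w ++ l)) ≡
    prodF F (Vec.toList w) 𝔽.+ windowSum (suc m) N (nth (Vec.toList (Vec.tail w) ++ l))
  windowSum-prefix {m} N w@(_ ∷ w′) l = trans
    (windowSum-suc (suc m) N (nth (Vec.toList w ++ l)))
    (cong (λ q → prodF F q 𝔽.+ windowSum (suc m) N (nth (Vec.toList w′ ++ l))) (nth-prefix w l))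

  -- Sums over words, read letter by letter

  ∑-points-suc : ∀ n (f : Vec Carrier (suc n) → ℤ) →
    ∑ (points F (suc n)) f ≡ ∑ elements (λ a → ∑ (points F n) (λ y → f (a ∷ y)))
  ∑-points-suc n f = trans (∑-concatMap _ elements f)
    (∑-cong elements (λ a → ∑-map (a ∷_) (points F n) f))

  ∑-points-+ : ∀ m n (f : Vec Carrier (m + n) → ℤ) →
    ∑ (points F (m + n)) f ≡ ∑ (points F m) (λ s → ∑ (points F n) (λ y → f (s Vec.++ y)))
  ∑-points-+ zero    n f = sym (ℤₚ.+-identityʳ _)
  ∑-points-+ (suc m) n f = trans (∑-points-suc (m + n) f)
    (trans (∑-cong elements (λ a → ∑-points-+ m n (λ x → f (a ∷ x))))
           (sym (∑-points-suc m _)))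

  -- Letting the state carry the partial sum c ∈ F, not its trace, makes
  -- additivity of the trace unnecessary.
  walks : ∀ {m} → Vec Carrier m → Vec Carrier m → Carrier → ℕ → Cyc p
  -- `s` holds the last `m` letters read and `t` the letters that close the cycle; the `m` windows
  -- starting inside `s` are still to be counted.
  walks {m} s t c zero      =
    χ (c 𝔽.+ windowSum (suc m) m (nth (Vec.toList s ++ Vec.toList t)))
  walks {m} s t c (suc n) j = ∑ elements λ a →
    walks (Vec.tail (s Vec.∷ʳ a)) t (c 𝔽.+ prodF F (Vec.toList (s Vec.∷ʳ a))) n j

  walks-cong : ∀ {m} (s t : Vec Carrier m) {c c′} → c 𝔽.≈ c′ → walks s t c ≈ₛ walks s t c′
  walks-cong s t e zero    j = χ-cong (𝔽.+-congʳ e) j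
  walks-cong s t e (suc n) j = ∑-cong elements λ a →
    walks-cong (Vec.tail (s Vec.∷ʳ a)) t (𝔽.+-congʳ e) n j

  -- Reading `a` moves the first window of the word `s a y t` from the window sum into `c`, by
  -- `windowSum-prefix`.
  walks-∑ : ∀ {m} (s t : Vec Carrier m) c n j → walks s t c n j ≡
    ∑ (points F n) (λ y → χ (c 𝔽.+ windowSum (suc m) (n + m)
      (nth (Vec.toList s ++ Vec.toList y ++ Vec.toList t))) j)
  walks-∑ s t c zero    j = sym (ℤₚ.+-identityʳ _)
  walks-∑ {m} s t c (suc n) j = trans
    (∑-cong elements λ a → trans
      (walks-∑ (Vec.tail (s Vec.∷ʳ a)) t _ n j)
      (∑-cong (points F n) (step a)))
    (sym (∑-points-suc n _))
    where
    step : ∀ a (y : Vec Carrier n) →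
      χ ((c 𝔽.+ prodF F (Vec.toList (s Vec.∷ʳ a))) 𝔽.+ windowSum (suc m) (n + m)
        (nth (Vec.toList (Vec.tail (s Vec.∷ʳ a)) ++ Vec.toList y ++ Vec.toList t))) j ≡
      χ (c 𝔽.+ windowSum (suc m) (suc n + m)
        (nth (Vec.toList s ++ a ∷ Vec.toList y ++ Vec.toList t))) j
    step a y = trans (χ-cong (𝔽.+-assoc c _ _) j) (cong (λ z → χ (c 𝔽.+ z) j)
      (trans (sym (windowSum-prefix (n + m) (s Vec.∷ʳ a) _))
        (cong (λ q → windowSum (suc m) (suc n + m) (nth q))
          (trans (cong (_++ (Vec.toList y ++ Vec.toList t)) (Vecₚ.toList-∷ʳ a s))
                 (Listₚ.++-assoc (Vec.toList s) (a ∷ []) _)))))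

  -- Unrolling the cyclic indices

  nth-++ʳ : ∀ {N} (x : Vec Carrier N) l i → nth (Vec.toList x ++ l) (N + i) ≡ nth l i
  nth-++ʳ []      l i = refl
  nth-++ʳ (_ ∷ x) l i = nth-++ʳ x l i

  nth-lookup : ∀ {N} (x : Vec Carrier N) l i → nth (Vec.toList x ++ l) (toℕ i) ≡ Vec.lookup x i
  nth-lookup (_ ∷ x) l Fin.zero    = refl
  nth-lookup (_ ∷ x) l (Fin.suc i) = nth-lookup x l i

  lookup-mod : ∀ {M} (x : Vec Carrier (suc M)) l {i} → i < suc M →
    Vec.lookup x (i mod suc M) ≡ nth (Vec.toList x ++ l) i
  lookup-mod {M} x l {i} i<N = trans (sym (nth-lookup x l (i mod suc M)))
    (cong (nth (Vec.toList x ++ l))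
      (trans (Finₚ.toℕ-fromℕ< (m%n<n i (suc M))) (m<n⇒m%n≡m i<N)))

  -- A window of length `m + 2` runs past the end by at most `m + 1` letters, so repeating `s` after
  -- the word replaces the wrap-around.
  R-windowSum : ∀ {m l} (s : Vec Carrier (suc m)) (y : Vec Carrier l) →
    R F (2 + m) (s Vec.++ y) ≡ windowSum (2 + m) (suc m + l)
      (nth (Vec.toList s ++ Vec.toList y ++ Vec.toList s))
  R-windowSum {m} {l} s y = windowSum-cong (suc m) (suc m + l) eq
    where
    N = suc m + l
    x = s Vec.++ y
    reassoc : ∀ q → Vec.toList x ++ q ≡ Vec.toList s ++ Vec.toList y ++ q
    reassoc q = trans (cong (_++ q) (Vecₚ.toList-++ s y)) (Listₚ.++-assoc (Vec.toList s) _ q)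
    eq : ∀ i → i < N + suc m → Vec.lookup x (i mod N) ≡
      nth (Vec.toList s ++ Vec.toList y ++ Vec.toList s) i
    eq i i<N+m with i ℕₚ.<? N
    ... | yes i<N = trans (lookup-mod x (Vec.toList s) i<N)
                          (cong (λ q → nth q i) (reassoc (Vec.toList s)))
    -- Here `i mod N` is `i′ = i − N`, and `i′ < m + 1` lies within `s`.
    ... | no  i≮N = begin
      Vec.lookup x (i mod N)
        ≡⟨ cong (Vec.lookup x) (Finₚ.toℕ-injective (begin
             toℕ (i mod N)   ≡⟨ Finₚ.toℕ-fromℕ< (m%n<n i N) ⟩
             i % N           ≡⟨ cong (_% N) (trans (sym N+i′≡i) (ℕₚ.+-comm N i′)) ⟩
             (i′ + N) % N    ≡⟨ [m+n]%n≡m%n i′ N ⟩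
             i′ % N          ≡⟨ Finₚ.toℕ-fromℕ< (m%n<n i′ N) ⟨
             toℕ (i′ mod N)  ∎)) ⟩
      Vec.lookup x (i′ mod N)
        ≡⟨ lookup-mod x [] (ℕₚ.<-≤-trans i′<m (ℕₚ.m≤m+n (suc m) l)) ⟩
      nth (Vec.toList x ++ []) i′
        ≡⟨ cong (λ q → nth q i′) (reassoc []) ⟩
      nth (Vec.toList s ++ Vec.toList y ++ []) i′
        -- Since position `i′` is in `s`, the letters after `s` can be exchanged.
        ≡⟨ lookup-mod s _ i′<m ⟨
      Vec.lookup s (i′ mod suc m)
        ≡⟨ lookup-mod s [] i′<m ⟩
      nth (Vec.toList s ++ []) i′
        ≡⟨ cong (λ q → nth q i′) (Listₚ.++-identityʳ (Vec.toList s)) ⟩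
      nth (Vec.toList s) i′
        ≡⟨ nth-++ʳ x (Vec.toList s) i′ ⟨
      nth (Vec.toList x ++ Vec.toList s) (N + i′)
        ≡⟨ cong₂ nth (reassoc (Vec.toList s)) N+i′≡i ⟩
      nth (Vec.toList s ++ Vec.toList y ++ Vec.toList s) i ∎
      where
      open ≡-Reasoning
      i′ = i ∸ N
      N+i′≡i : N + i′ ≡ i
      N+i′≡i = ℕₚ.m+[n∸m]≡n (ℕₚ.≮⇒≥ i≮N)
      i′<m : i′ < suc m
      i′<m = ℕₚ.+-cancelˡ-< N i′ (suc m) (subst (_< N + suc m) (sym N+i′≡i) i<N+m)

  -- The word starts with `s` and must close up with the same `s`: this is the trace of a power of
  -- the transfer matrix.
  S-R-∑ : ∀ m l j → S-R F p r (2 + m) (suc m + l) j ≡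
    ∑ (points F (suc m)) (λ s → walks s s 𝔽.0# l j)
  S-R-∑ m l j = trans
    (length-filter-∑ (λ x → trace F p r (R F (2 + m) x) 𝔽.≟ natElem F (toℕ j))
                     (points F (suc m + l)))
    (trans (∑-points-+ (suc m) l (λ x → χ (R F (2 + m) x) j))
    (∑-cong (points F (suc m)) λ s → trans
      (∑-cong (points F l) λ y → trans
        (cong (λ z → χ z j) (trans (R-windowSum s y)
          (cong (λ N → windowSum (2 + m) N (word s y)) (ℕₚ.+-comm (suc m) l))))
        (χ-cong (𝔽.sym (𝔽.+-identityˡ _)) j))
      (sym (walks-∑ s s 𝔽.0# l j))))
    where
    word : Vec Carrier (suc m) → Vec Carrier l → ℕ → Carrier
    word s y = nth (Vec.toList s ++ Vec.toList y ++ Vec.toList s)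

  -- The finite linear system of walks

  ∷∈points : ∀ {n a} {x : Vec Carrier n} → a ∈ elements → x ∈ points F n →
    (a ∷ x) ∈ points F (suc n)
  ∷∈points a∈ x∈ = ∈-concatMap⁺ _ (lose a∈ (∈-map⁺ (_ ∷_) x∈))

  ∷∈points⁻ : ∀ {n a} {x : Vec Carrier n} → (a ∷ x) ∈ points F (suc n) →
    a ∈ elements × x ∈ points F n
  ∷∈points⁻ {n} ax∈ with find (∈-concatMap⁻ (λ a → map (a ∷_) (points F n)) {xs = elements} ax∈)
  ... | b , b∈ , ax∈′ with ∈-map⁻ (b ∷_) ax∈′
  ... | x , x∈ , refl = b∈ , x∈

  ∷ʳ∈points : ∀ {n a} {x : Vec Carrier n} → x ∈ points F n → a ∈ elements →
    (x Vec.∷ʳ a) ∈ points F (suc n)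
  ∷ʳ∈points {x = []}    x∈ a∈ = ∷∈points a∈ (here refl)
  ∷ʳ∈points {x = _ ∷ _} x∈ a∈ with ∷∈points⁻ x∈
  ... | b∈ , x′∈ = ∷∈points b∈ (∷ʳ∈points x′∈ a∈)

  tail∈points : ∀ {n} {x : Vec Carrier (suc n)} → x ∈ points F (suc n) →
    Vec.tail x ∈ points F n
  tail∈points {x = _ ∷ _} x∈ = proj₂ (∷∈points⁻ x∈)

  State : ℕ → Set
  State m = Vec Carrier m × Vec Carrier m × Carrier

  states : ∀ m → List (State m)
  states m = cartesianProduct (points F m) (cartesianProduct (points F m) elements)

  stateWalks : ∀ {m} → State m → Seq
  stateWalks (s , t , c) = walks s t c

  -- The partial sum `c` need not be listed literally, so it is replaced by its representative in
  -- `elements`. The letters of `s` and `t` are drawn from `elements` throughout.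
  walks∈Span : ∀ {m} {s t : Vec Carrier m} → s ∈ points F m → t ∈ points F m →
    ∀ c → Span 1 (map stateWalks (states m)) (walks s t c)
  walks∈Span {s = s} {t} s∈ t∈ c with find (𝔽.complete c)
  ... | c′ , c′∈ , c≈c′ = Span-member (Anyₚ.map⁺ (lose
    (∈-cartesianProduct⁺ s∈ (∈-cartesianProduct⁺ t∈ c′∈))
    (walks-cong s t c≈c′)))

  -- The recursion defining `walks` is a row of the transfer matrix: a sum over the successor
  -- states.
  shift-walks∈Span : ∀ {m} {s t : Vec Carrier m} → s ∈ points F m → t ∈ points F m →
    ∀ c → Span 1 (map stateWalks (states m)) (shift 1 (walks s t c))
  shift-walks∈Span s∈ t∈ c = Span-∑ elements _ λ a∈ →
    walks∈Span (tail∈points (∷ʳ∈points s∈ a∈)) t∈ _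

  states-closed : ∀ m → All (λ w → Span 1 (map stateWalks (states m)) (shift 1 w))
    (map stateWalks (states m))
  states-closed m = Allₚ.map⁺ (All.tabulate λ {(s , t , c)} st∈ →
    let s∈ , tc∈ = ∈-cartesianProduct⁻ (points F m) _ st∈
        t∈ , _   = ∈-cartesianProduct⁻ (points F m) elements tc∈
    in shift-walks∈Span s∈ t∈ c)

  S-R-recurrence : ∀ m → ∃[ d ] ∃ λ (a : Fin d → ℤ) → ∀ l j →
    S-R F p r (2 + m) (suc m + (l + d)) j ≡
    sumᶜ d (λ i → a i ·ᶜ S-R F p r (2 + m) (suc m + (l + toℕ i))) j
  S-R-recurrence m = linearRecurrence (map stateWalks (states (suc m)))
    {u = λ l → S-R F p r (2 + m) (suc m + l)}
    (states-closed (suc m))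
    -- `u` is not among the unknowns; its shift is the sum of the shifted walks from `s` to `s`,
    -- each a row of the system.
    (Span-resp (λ l j → sym (S-R-∑ m (suc l) j))
      (Span-∑ (points F (suc m)) _ λ s∈ → shift-walks∈Span s∈ s∈ 𝔽.0#))

-- The recurrence for the exponential sums

theorem3p6 : (k : ℕ) → 2 ≤ k → (p r : ℕ) → Prime p → 1 ≤ r →
    (F : FiniteField) → FiniteField.cardinality F ≡ p ^ r →
    ∃[ d ] ∃ λ (a : Fin d → ℤ) → ∀ n → k ≤ n →
    S-R F p r k (n + d) ≈ᶜ sumᶜ d (λ i → a i ·ᶜ S-R F p r k (n + toℕ i))
theorem3p6 (suc (suc m)) (s≤s (s≤s _)) p r _ _ F _ with Transfer.S-R-recurrence F p r m
... | d , a , rec = d , a , λ n k≤n →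
  -- With `k = m + 2`, the cut removes `k − 1 = suc m` letters and leaves `l = n − suc m`.
  subst Recurs (ℕₚ.m+[n∸m]≡n (ℕₚ.<⇒≤ k≤n)) (recurs (n ∸ suc m))
  where
  open Recurrence {p}
  S = S-R F p r (2 + m)
  Recurs : ℕ → Set
  Recurs n = S (n + d) ≈ᶜ sumᶜ d (λ i → a i ·ᶜ S (n + toℕ i))
  recurs : ∀ l → Recurs (suc m + l)
  -- The coefficient vectors agree exactly, so the constant required by `_≈ᶜ_` is 0.
  recurs l = 0ℤ , λ j → ℤₚ.i≡j⇒i-j≡0 (begin
    S (suc m + l + d) j
      ≡⟨ cong (λ n → S n j) (ℕₚ.+-assoc (suc m) l d) ⟩
    S (suc m + (l + d)) j
      ≡⟨ rec l j ⟩
    sumᶜ d (λ i → a i ·ᶜ S (suc m + (l + toℕ i))) j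
      ≡⟨ sumᶜ-cong d (λ i j → cong (λ n → a i ℤ.* S n j)
           (sym (ℕₚ.+-assoc (suc m) l (toℕ i)))) j ⟩
    sumᶜ d (λ i → a i ·ᶜ S (suc m + l + toℕ i)) j ∎)
    where open ≡-Reasoning
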